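{- Every oriented ray with a bounded representing sequence is not ubiquitous.
   Context: An oriented ray is a digraph whose underlying undirected graph is a ray (one-way infinite path) with first vertex the unique vertex of undirected degree $1$. An arc is in-oriented if it points towards the first vertex and out-oriented otherwise. A phase of an oriented ray is a maximal consistently directed path (dipath) contained in it; its length is its number of arcs. For an oriented ray with infinitely many in-oriented and infinitely many out-oriented arcs, its phases can be listed in order from the first vertex, and its representing sequence is the sequence of natural numbers whose $n$-th term is the length of the $n$-th phase. The representing sequence is bounded if there is $b\in\mathbb N$ such that all its terms lie in $\{1,\dots,b\}$, and unbounded otherwise. A digraph $H$ is ubiquitous if every digraph which, for every $k\in\mathbb N$, contains $k$ pairwise vertex-disjoint subdigraphs isomorphic to $H$ also contains infinitely many pairwise vertex-disjoint subdigraphs isomorphic to $H$. -}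

module Defs where

open import Data.Nat using (ℕ; zero; suc; _+_; _≤_; _<_)
open import Data.Bool using (Bool; true; false; not)
open import Data.Fin using (Fin)
open import Data.Product using (Σ; _×_)
open import Data.Sum using (_⊎_)
open import Relation.Binary.PropositionalEquality using (_≡_)
open import Relation.Nullary using (¬_)

record Digraph : Set₁ where
  field
    V   : Set
    Arc : V → V → Set
open Digraph public

-- A subdigraph of G isomorphic to H: an injective map on vertices sending
-- arcs of H to arcs of G (the image together with the image arcs is a
-- subdigraph of G isomorphic to H).
record Copy (H G : Digraph) : Set where
  field
    map    : V H → V G
    inj    : ∀ x y → map x ≡ map y → x ≡ y
    arcs   : ∀ x y → Arc H x y → Arc G (map x) (map y)
open Copy public

Disjoint : {I : Set} {H G : Digraph} → (I → Copy H G) → Set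
Disjoint {I} {H} c = ∀ (i j : I) (x y : V H) → map (c i) x ≡ map (c j) y → i ≡ j

HasDisjointCopies : Digraph → Digraph → ℕ → Set
HasDisjointCopies H G k = Σ (Fin k → Copy H G) Disjoint

HasInfDisjointCopies : Digraph → Digraph → Set
HasInfDisjointCopies H G = Σ (ℕ → Copy H G) Disjoint

Ubiquitous : Digraph → Set₁
Ubiquitous H = (G : Digraph) → (∀ k → HasDisjointCopies H G k) → HasInfDisjointCopies H G

OrientedRay : (ℕ → Bool) → Digraph
OrientedRay o = record
  { V   = ℕ
  ; Arc = λ u v → (v ≡ suc u × o u ≡ true) ⊎ (u ≡ suc v × o v ≡ false) }

psum : (ℕ → ℕ) → ℕ → ℕ
psum s zero    = 0
psum s (suc k) = psum s k + s k

alt : Bool → ℕ → Bool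
alt d zero    = d
alt d (suc k) = not (alt d k)

-- s is the representing sequence of the oriented ray with orientation o:
-- every term is a positive natural number, and the k-th phase consists of
-- the arcs n with psum s k ≤ n < psum s (k+1), all oriented alike, with
-- consecutive phases oppositely oriented (so phases are maximal dipaths,
-- and there are infinitely many in- and out-oriented arcs).
IsRepresentingSequence : (ℕ → Bool) → (ℕ → ℕ) → Set
IsRepresentingSequence o s =
  (∀ k → 1 ≤ s k) ×
  (∀ k n → psum s k ≤ n → n < psum s (suc k) → o n ≡ alt (o 0) k)

BoundedSeq : (ℕ → ℕ) → Set
BoundedSeq s = Σ ℕ λ b → ∀ n → s n ≤ b

{-# OPTIONS --safe #-}

-- Let L d be the largest length that occurs infinitely often among the runs of
-- arcs of orientation d.  Take rays R₍ₙ,ᵢ₎, all copies of the given one, and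
-- for any two of them that do not belong to a common finite family
-- {R₍ₙ,ᵢ₎ : i < n} identify, infinitely often, the end of an out-oriented run
-- of length L true on one with the end of an in-oriented run of length L false
-- on the other.  All arcs of the first ray at such a vertex point into it and
-- all arcs of the second point out of it, so a copy that moves away from the
-- start of a ray and changes rays would prolong a run that is already maximal.
-- The crossings are ordered so that a copy cannot move towards the starts
-- forever, hence it is eventually a tail of one of the rays.  Tails of distinct
-- rays outside a common family meet, and each family is finite.
--
-- The goal being a negation, the classical choices (L d, the eventual ray of a
-- copy, the existence of the meeting vertices) are only made under ¬ ¬.
module Submission where

open import Defs
open import Data.Nat using (ℕ; zero; suc; _+_; _*_; _∸_; _⊔_; _≤_; _<_; z≤n; s≤s; _<?_; _≤?_)
open import Data.Nat.Properties
open import Data.Bool using (Bool; true; false; not)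
open import Data.Bool.Properties using (not-¬; ¬-not; not-involutive) renaming (_≟_ to _≟ᵇ_)
open import Data.Empty using (⊥; ⊥-elim)
open import Data.Fin using (Fin; toℕ; fromℕ<; zero; suc)
open import Data.Fin.Properties using (toℕ<n; toℕ-injective; toℕ-fromℕ<; pigeonhole)
open import Data.Product using (_×_; _,_; proj₁; proj₂; ∃-syntax)
open import Data.Product.Properties using (≡-dec)
open import Data.Sum using (_⊎_; inj₁; inj₂)
open import Function using (_∘_)
open import Relation.Binary using (DecidableEquality)
open import Relation.Binary.PropositionalEquality using (_≡_; _≢_; refl; sym; trans; cong; cong₂; subst; subst₂)
open import Relation.Nullary using (¬_; Dec; yes; no)
open import Relation.Nullary.Decidable using (_×-dec_; ¬?; ¬¬-excluded-middle; decidable-stable)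

-- Finiteness of the index set makes this double-negation shift constructive; it lets several copies
-- be settled at once.
¬¬-∀Fin : ∀ n {P : Fin n → Set} → (∀ i → ¬ ¬ P i) → ¬ ¬ (∀ i → P i)
¬¬-∀Fin zero    h k = k λ ()
¬¬-∀Fin (suc n) h k =
  h zero λ p → ¬¬-∀Fin n (h ∘ suc) λ ps → k λ { zero → p ; (suc i) → ps i }

<-snoc : ∀ {P : ℕ → Set} {k} → (∀ {i} → i < k → P i) → P k → ∀ {i} → i < suc k → P i
<-snoc below top (s≤s i≤k) with m≤n⇒m<n∨m≡n i≤k
... | inj₁ i<k  = below i<k
... | inj₂ refl = top

-- Runs of equally oriented arcs

-- The ℓ arcs preceding vertex e have orientation d (meaningful for ℓ ≤ e only,
-- because of the truncated subtraction).
Run : (ℕ → Bool) → Bool → ℕ → ℕ → Set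
Run o d ℓ e = ∀ {i} → i < ℓ → o (e ∸ suc i) ≡ d

RunsBounded : (ℕ → Bool) → Bool → ℕ → ℕ → Set
RunsBounded o d T ℓ = ∀ e → T + ℓ < e → ¬ Run o d (suc ℓ) e

RunsRecur : (ℕ → Bool) → Bool → ℕ → Set
RunsRecur o d ℓ = ∀ M → ¬ ¬ (∃[ e ] M ≤ e × Run o d ℓ e)

Run-extend : ∀ o {d ℓ e} → Run o d ℓ e → o e ≡ d → Run o d (suc ℓ) (suc e)
Run-extend o run oe {zero}  _         = oe
Run-extend o run oe {suc i} (s≤s i<ℓ) = run i<ℓ

RunsBounded-mono : ∀ o {d T T′ ℓ} → T ≤ T′ → RunsBounded o d T ℓ → RunsBounded o d T′ ℓ
RunsBounded-mono o T≤T′ bounded e lt = bounded e (≤-<-trans (+-monoˡ-≤ _ T≤T′) lt)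

-- Descent from a valid bound: if `ℓ` also bounds the runs eventually, the search goes on with `ℓ`;
-- if not, runs of length `suc ℓ` recur. Empty runs always recur.
largest-recurring-run : ∀ o d ℓ → ∃[ T ] RunsBounded o d T ℓ →
                        ¬ ¬ (∃[ ℓ′ ] (∃[ T ] RunsBounded o d T ℓ′) × RunsRecur o d ℓ′)
largest-recurring-run o d zero    bd k = k (0 , bd , λ M h → h (M , ≤-refl , λ ()))
largest-recurring-run o d (suc ℓ) bd k = ¬¬-excluded-middle λ where
  (yes bd′) → largest-recurring-run o d ℓ bd′ k
  (no ¬bd′) → k (suc ℓ , bd , λ M h → ¬bd′ (M , λ e lt run →
    h (e , ≤-trans (m≤m+n M ℓ) (<⇒≤ lt) , run)))

-- If `ℓ` were 0, every arc from `T` on would have orientation `not d`, giving a run longer than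
-- `b`.
recurring-run-positive : ∀ o d {T b ℓ} → RunsBounded o (not d) 0 b → RunsBounded o d T ℓ → 1 ≤ ℓ
recurring-run-positive o d {ℓ = suc ℓ} _ _ = s≤s z≤n
recurring-run-positive o d {T} {b} {zero} bounded′ bounded =
  ⊥-elim (bounded′ (suc (T + b)) (s≤s (m≤n+m b T)) run)
  where
  run : Run o (not d) (suc b) (suc (T + b))
  run {i} (s≤s i≤b) = ¬-not λ od →
    bounded (suc (T + b ∸ i))
      (s≤s (≤-trans (+-monoʳ-≤ T z≤n) (≤-reflexive (sym (+-∸-assoc T i≤b)))))
      (λ { {zero} _ → od ; {suc _} (s≤s ()) })

module _ (o : ℕ → Bool) (s : ℕ → ℕ) (rep : IsRepresentingSequence o s) where

  phase-of : ∀ n → ∃[ k ] psum s k ≤ n × n < psum s (suc k)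
  phase-of zero = 0 , z≤n , proj₁ rep 0
  phase-of (suc n) with phase-of n
  ... | k , lo , hi with suc n <? psum s (suc k)
  ...   | yes hi′ = k , m≤n⇒m≤1+n lo , hi′
  ...   | no ¬hi′ = suc k , ≮⇒≥ ¬hi′ ,
          ≤-trans (s≤s hi) (≤-trans (≤-reflexive (+-comm 1 _)) (+-monoʳ-≤ _ (proj₁ rep (suc k))))

  -- The phase of the first arc of the run has at most `b` arcs, so the next phase, oppositely
  -- oriented, starts inside the run.
  bounded-phases⇒bounded-runs : ∀ {b} → (∀ n → s n ≤ b) → ∀ d → RunsBounded o d 0 b
  bounded-phases⇒bounded-runs {b} s≤b d (suc e) (s≤s b≤e) run with phase-of (e ∸ b)
  ... | k , lo , hi = not-¬ (trans o-next (trans (sym (run (s≤s ≤-refl))) o-here)) o-skip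
    where
    p : ℕ
    p = psum s (suc k)
    p≤e : p ≤ e
    p≤e = ≤-trans (+-mono-≤ lo (s≤b k)) (≤-reflexive (m∸n+n≡m b≤e))
    e∸p≤b : e ∸ p ≤ b
    e∸p≤b = m≤n+o⇒m∸n≤o e p (≤-trans (≤-reflexive (sym (m∸n+n≡m b≤e))) (+-monoˡ-≤ b (<⇒≤ hi)))
    o-here : o (e ∸ b) ≡ alt (o 0) k
    o-here = proj₂ rep k (e ∸ b) lo hi
    o-next : o p ≡ d
    o-next = subst (λ x → o x ≡ d) (m∸[m∸n]≡n p≤e) (run (s≤s e∸p≤b))
    o-skip : o p ≡ not (alt (o 0) k)
    o-skip = proj₂ rep (suc k) p ≤-refl
      (≤-trans (≤-reflexive (+-comm 1 _)) (+-monoʳ-≤ _ (proj₁ rep (suc k))))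

-- The graph of crossing rays

module Crossing
  (o : ℕ → Bool) (T : ℕ) (L : Bool → ℕ)
  (L≥1 : ∀ d → 1 ≤ L d) (bounded : ∀ d → RunsBounded o d T (L d))
  {Ray : Set} (_≟ʳ_ : DecidableEquality Ray)
  (ends : ℕ → Bool → Ray) (ends-distinct : ∀ c → ends c true ≢ ends c false)
  where

  -- The lower bound on `e` lets `bounded` exclude a prolongation of the run to `suc e`.
  MaxRun : Bool → ℕ → Set
  MaxRun d e = T + L d ≤ e × Run o d (L d) e

  maxRun? : ∀ d e → Dec (MaxRun d e)
  maxRun? d e = (T + L d ≤? e) ×-dec allUpTo? (λ i → o (e ∸ suc i) ≟ᵇ d) (L d)

  MaxRun-ends : ∀ {d e} → MaxRun d e → o e ≡ not d
  MaxRun-ends {d} {e} (le , run) = ¬-not λ oe → bounded d (suc e) (s≤s le) (Run-extend o run oe)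

  -- Scanning a ray from its start, state (c , d) means that the next maximal
  -- run of orientation d is the one that ray ends c d uses for crossing c.
  State : Set
  State = ℕ × Bool

  next : State → State
  next (c , true)  = c , false
  next (c , false) = suc c , true

  advance : ∀ (σ : State) {A : Set} → Dec A → State
  advance σ (yes _) = next σ
  advance σ (no _)  = σ

  state : ℕ → State
  state zero    = 0 , true
  state (suc m) = advance (state m) (maxRun? (proj₂ (state m)) (suc m))

  -- The state is read at `m` because `state (suc m)` has already moved past a run that ends at
  -- `suc m`.
  Side : Ray → ℕ → ℕ → Bool → Set
  Side r zero    c d = ⊥
  Side r (suc m) c d = state m ≡ (c , d) × MaxRun d (suc m) × ends c d ≡ r

  Vertex : Set
  Vertex = ℕ ⊎ (Ray × ℕ)

  pattern crossing c = inj₁ c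
  pattern plain r m  = inj₂ (r , m)

  place : ∀ {A B : Set} → Ray → ℕ → ℕ → Dec A → Dec B → Vertex
  place r m c (yes _) (yes _) = crossing c
  place r m c (yes _) (no _)  = plain r m
  place r m c (no _)  _       = plain r m

  vertex : Ray → ℕ → Vertex
  vertex r zero    = plain r 0
  vertex r (suc m) with state m
  ... | c , d = place r (suc m) c (maxRun? d (suc m)) (ends c d ≟ʳ r)

  -- The union of all rays after gluing by `vertex`; glued positions leave their `plain` vertices
  -- behind as isolated ones.
  G : Digraph
  G = record
    { V   = Vertex
    ; Arc = λ u v → ∃[ r ] ∃[ x ] ∃[ y ]
              Arc (OrientedRay o) x y × u ≡ vertex r x × v ≡ vertex r y }

  vertex-view : ∀ r m → (∃[ c ] ∃[ d ] Side r m c d × vertex r m ≡ crossing c) ⊎ vertex r m ≡ plain r m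
  vertex-view r zero = inj₂ refl
  vertex-view r (suc m) with state m
  ... | c , d with maxRun? d (suc m) | ends c d ≟ʳ r
  ...   | yes w | yes eq = inj₁ (c , d , (refl , w , eq) , refl)
  ...   | yes w | no _   = inj₂ refl
  ...   | no _  | _      = inj₂ refl

  Side⇒crossing : ∀ {r m c d} → Side r m c d → vertex r m ≡ crossing c
  Side⇒crossing {r} {suc m} {c} {d} (st , w , eq) with state m | st
  ... | .(c , d) | refl with maxRun? d (suc m) | ends c d ≟ʳ r
  ...   | yes _ | yes _  = refl
  ...   | yes _ | no ¬eq = ⊥-elim (¬eq eq)
  ...   | no ¬w | _      = ⊥-elim (¬w w)

  Side-before : ∀ {r m c d} → Side r (suc m) c d → o m ≡ d
  Side-before {d = d} (_ , (_ , run) , _) = run (L≥1 d)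

  Side-after : ∀ {r m c d} → Side r m c d → o m ≡ not d
  Side-after {m = suc m} (_ , w , _) = MaxRun-ends w

  state-advances : ∀ m {c d} → state m ≡ (c , d) → MaxRun d (suc m) → state (suc m) ≡ next (c , d)
  state-advances m {c} {d} st w with state m | st
  ... | .(c , d) | refl with maxRun? d (suc m)
  ...   | yes _ = refl
  ...   | no ¬w = ⊥-elim (¬w w)

  state-stays : ∀ m {c d} → state m ≡ (c , d) → ¬ MaxRun d (suc m) → state (suc m) ≡ (c , d)
  state-stays m {c} {d} st ¬w with state m | st
  ... | .(c , d) | refl with maxRun? d (suc m)
  ...   | yes w = ⊥-elim (¬w w)
  ...   | no _  = refl

  stage≤position : ∀ m → proj₁ (state m) ≤ m
  stage≤position zero = z≤n
  stage≤position (suc m) with state m | stage≤position m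
  ... | c , d | c≤m with maxRun? d (suc m)
  stage≤position (suc m) | c , true  | c≤m | yes _ = m≤n⇒m≤1+n c≤m
  stage≤position (suc m) | c , false | c≤m | yes _ = s≤s c≤m
  stage≤position (suc m) | c , d     | c≤m | no _  = m≤n⇒m≤1+n c≤m

  -- The rank is nondecreasing along every ray, strictly increasing into a
  -- crossing, and both rays through a crossing give it the same rank; this is
  -- why ends c true skips the value suc (c * 2).
  rank : Ray → State → ℕ
  rank r (c , true) = c * 2
  rank r (c , false) with ends c true ≟ʳ r
  ... | yes _ = suc (suc (c * 2))
  ... | no _  = suc (c * 2)

  rank-next : ∀ r σ → rank r σ ≤ rank r (next σ)
  rank-next r (c , true) with ends c true ≟ʳ r
  ... | yes _ = m≤n+m (c * 2) 2
  ... | no _  = m≤n+m (c * 2) 1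
  rank-next r (c , false) with ends c true ≟ʳ r
  ... | yes _ = ≤-refl
  ... | no _  = n≤1+n _

  rank-step : ∀ r m → rank r (state m) ≤ rank r (state (suc m))
  rank-step r m with maxRun? (proj₂ (state m)) (suc m)
  ... | yes _ = rank-next r (state m)
  ... | no _  = ≤-refl

  rank-mono : ∀ r {m n} → m ≤ n → rank r (state m) ≤ rank r (state n)
  rank-mono r {n = zero} z≤n = ≤-refl
  rank-mono r {m} {suc n} m≤1+n with m≤n⇒m<n∨m≡n m≤1+n
  ... | inj₁ (s≤s m≤n) = ≤-trans (rank-mono r m≤n) (rank-step r n)
  ... | inj₂ refl      = ≤-refl

  rank-before-crossing : ∀ {r m c d} → Side r (suc m) c d → rank r (state m) < suc c * 2
  rank-before-crossing {c = c} {true} (st , _ , _) rewrite st = m≤n+m (suc (c * 2)) 1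
  rank-before-crossing {r} {c = c} {false} (st , _ , eq) rewrite st with ends c true ≟ʳ r
  ... | yes eq′ = ⊥-elim (ends-distinct c (trans eq′ (sym eq)))
  ... | no _    = ≤-refl

  rank-at-crossing : ∀ {r m c d} → Side r m c d → rank r (state m) ≡ suc c * 2
  rank-at-crossing {r} {suc m} {c} {true} (st , w , eq)
    rewrite state-advances m st w with ends c true ≟ʳ r
  ... | yes _  = refl
  ... | no ¬eq = ⊥-elim (¬eq eq)
  rank-at-crossing {r} {suc m} {c} {false} (st , w , eq)
    rewrite state-advances m st w = refl

  -- At `m` the rank has already reached `suc c * 2`; just before a later visit to the same crossing
  -- it would still be smaller.
  Side-≮ : ∀ {r m m′ c d d′} → Side r m c d → Side r m′ c d′ → ¬ m < m′
  Side-≮ {r} {m′ = suc m′} side side′ (s≤s m≤m′) =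
    <-irrefl (rank-at-crossing side) (≤-<-trans (rank-mono r m≤m′) (rank-before-crossing side′))

  Side-unique : ∀ {r m m′ c d d′} → Side r m c d → Side r m′ c d′ → m ≡ m′
  Side-unique side side′ = ≤-antisym (≮⇒≥ (Side-≮ side′ side)) (≮⇒≥ (Side-≮ side side′))

  Side-ray : ∀ {r m c d} → Side r m c d → ends c d ≡ r
  Side-ray {m = suc m} (_ , _ , eq) = eq

  Meet : Ray → ℕ → Ray → ℕ → Set
  Meet r m r′ m′ = ∃[ c ] ∃[ d ] Side r m c d × Side r′ m′ c (not d)

  vertex-meet : ∀ {r m r′ m′} → vertex r m ≡ vertex r′ m′ → (r ≡ r′ × m ≡ m′) ⊎ Meet r m r′ m′
  vertex-meet {r} {m} {r′} {m′} eq with vertex-view r m | vertex-view r′ m′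
  ... | inj₂ v | inj₂ v′ with trans (sym v) (trans eq v′)
  ...   | refl = inj₁ (refl , refl)
  vertex-meet eq | inj₂ v | inj₁ (_ , _ , _ , v′) with trans (sym v) (trans eq v′)
  ...   | ()
  vertex-meet eq | inj₁ (_ , _ , _ , v) | inj₂ v′ with trans (sym v) (trans eq v′)
  ...   | ()
  vertex-meet eq | inj₁ (c , d , side , v) | inj₁ (_ , d′ , side′ , v′)
    with trans (sym v) (trans eq v′)
  ...   | refl with d′ ≟ᵇ d
  ...     | no d′≢d  = inj₂ (c , d , side , subst (Side _ _ c) (¬-not d′≢d) side′)
  ...     | yes refl with trans (sym (Side-ray side)) (Side-ray side′)
  ...       | refl = inj₁ (refl , Side-unique side side′)

  vertex-injective : ∀ r {m m′} → vertex r m ≡ vertex r m′ → m ≡ m′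
  vertex-injective r eq with vertex-meet eq
  ... | inj₁ (_ , m≡m′)              = m≡m′
  ... | inj₂ (_ , _ , side , side′) = Side-unique side side′

  ray-copy : Ray → Copy (OrientedRay o) G
  ray-copy r = record
    { map  = vertex r
    ; inj  = λ _ _ → vertex-injective r
    ; arcs = λ x y a → r , x , y , a , refl , refl }

  -- The runs of a ray that end at crossings do not overlap.
  Side-gap : ∀ {r r′ m c d c′ d′} k → Side r m c d → Side r′ (suc k + m) c′ d′ → L d′ ≤ suc k
  Side-gap {m = suc m} {d = d} {d′ = d′} k side (_ , (_ , run) , _) = ≮⇒≥ λ k<L →
    not-¬ (subst (λ x → o x ≡ d′) (m+n∸m≡n k (suc m)) (run (<-trans (n<1+n k) k<L)))
      (trans (Side-after side) (cong not (trans (sym (Side-before side))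
        (subst (λ x → o x ≡ d′) (trans (cong (_∸ suc k) (+-suc k m)) (m+n∸m≡n k m)) (run k<L)))))

  -- Every crossing is reached on both of its rays

  module Recurrent (recur : ∀ d → RunsRecur o d (L d)) where

    first-MaxRun : ∀ k {m c d} → state m ≡ (c , d) → MaxRun d (k + suc m) →
                   ∃[ m′ ] state m′ ≡ (c , d) × MaxRun d (suc m′)
    first-MaxRun zero    st w = _ , st , w
    first-MaxRun (suc k) {m} {c} {d} st w with maxRun? d (suc m)
    ... | yes w′ = m , st , w′
    ... | no ¬w′ = first-MaxRun k {suc m} (state-stays m st ¬w′) (subst (MaxRun d) (sym (+-suc k (suc m))) w)

    state-fires : ∀ {m c d} → state m ≡ (c , d) →
                  ¬ ¬ (∃[ m′ ] state m′ ≡ (c , d) × MaxRun d (suc m′))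
    state-fires {m} {c} {d} st k = recur d (suc m ⊔ (T + L d)) λ (e , le , run) →
      k (first-MaxRun (e ∸ suc m) {m} st
          (subst (MaxRun d) (sym (m∸n+n≡m (m⊔n≤o⇒m≤o (suc m) (T + L d) le))) (m⊔n≤o⇒n≤o (suc m) (T + L d) le , run)))

    next-reached : ∀ {σ} → ¬ ¬ (∃[ m ] state m ≡ σ) → ¬ ¬ (∃[ m ] state m ≡ next σ)
    next-reached reached k = reached λ (m₀ , st) → state-fires {m₀} st λ (m , st′ , w) →
      k (suc m , state-advances m st′ w)

    stage-reached : ∀ c → ¬ ¬ (∃[ m ] state m ≡ (c , true))
    stage-reached zero    k = k (0 , refl)
    stage-reached (suc c) = next-reached (next-reached (stage-reached c))

    state-reached : ∀ c d → ¬ ¬ (∃[ m ] state m ≡ (c , d))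
    state-reached c true  = stage-reached c
    state-reached c false = next-reached (stage-reached c)

    -- The bound `c ≤ e` places crossings with large `c` beyond any given position on both rays.
    crossing-reached : ∀ c d → ¬ ¬ (∃[ e ] c ≤ e × vertex (ends c d) e ≡ crossing c)
    crossing-reached c d k = state-reached c d λ (m₀ , st) → state-fires {m₀} st λ (m , st′ , w) →
      k (suc m ,
         m≤n⇒m≤1+n (subst (_≤ m) (cong proj₁ st′) (stage≤position m)) ,
         Side⇒crossing {m = suc m} (st′ , w , refl))

  -- Copies of the ray eventually follow a single ray

  module Tail (f : Copy (OrientedRay o) G) where

    -- In Outward n r m and Inward n r m, arc n of the copy is mapped to arc m of ray r.
    Outward : ℕ → Ray → ℕ → Set
    Outward n r m = map f n ≡ vertex r m × map f (suc n) ≡ vertex r (suc m) × o n ≡ o m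

    Inward : ℕ → Ray → ℕ → Set
    Inward n r m = map f n ≡ vertex r (suc m) × map f (suc n) ≡ vertex r m × o n ≡ not (o m)

    step : ∀ n → (∃[ r ] ∃[ m ] Outward n r m) ⊎ (∃[ r ] ∃[ m ] Inward n r m)
    step n with o n in on
    ... | true  with arcs f n (suc n) (inj₁ (refl , on))
    ...   | r , x , y , inj₁ (refl , ox) , u , v = inj₁ (r , x , u , v , sym ox)
    ...   | r , x , y , inj₂ (refl , oy) , u , v = inj₂ (r , y , u , v , sym (cong not oy))
    step n | false with arcs f (suc n) n (inj₂ (refl , on))
    ...   | r , x , y , inj₁ (refl , ox) , u , v = inj₂ (r , x , v , u , sym (cong not ox))
    ...   | r , x , y , inj₂ (refl , oy) , u , v = inj₁ (r , y , v , u , sym oy)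

    no-backtrack : ∀ {n v} → map f n ≡ v → map f (suc (suc n)) ≡ v → ⊥
    no-backtrack {n} p q = m≢1+m+n n (trans (inj f _ _ (trans p (sym q))) (cong suc (sym (+-comm n 1))))

    data Leaves (n : ℕ) (r : Ray) (m : ℕ) : Set where
      outward : ∀ {r′ m′} → Meet r m r′ m′ → Outward n r′ m′ → Leaves n r m
      inward  : ∀ {r′ m′} → Meet r m r′ (suc m′) → Inward n r′ m′ → Leaves n r m

    step-from : ∀ {n r m} → map f n ≡ vertex r m →
                Outward n r m ⊎ (∃[ m′ ] m ≡ suc m′ × Inward n r m′) ⊎ Leaves n r m
    step-from {n} {r} {m} p with step n
    ... | inj₁ (r′ , m′ , out) with vertex-meet {r} {m} {r′} {m′} (trans (sym p) (proj₁ out))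
    ...   | inj₁ (refl , refl) = inj₁ out
    ...   | inj₂ meet          = inj₂ (inj₂ (outward meet out))
    step-from {n} {r} {m} p | inj₂ (r′ , m′ , inw) with vertex-meet {r} {m} {r′} {suc m′} (trans (sym p) (proj₁ inw))
    ...   | inj₁ (refl , refl) = inj₂ (inj₁ (m′ , refl , inw))
    ...   | inj₂ meet          = inj₂ (inj₂ (inward meet inw))

    after-outward : ∀ {n r m} → Outward n r m → Outward (suc n) r (suc m) ⊎ Leaves (suc n) r (suc m)
    after-outward (p , q , _) with step-from q
    ... | inj₁ out                             = inj₁ out
    ... | inj₂ (inj₁ (_ , refl , _ , q′ , _)) = ⊥-elim (no-backtrack p q′)
    ... | inj₂ (inj₂ leaves)                   = inj₂ leaves

    after-inward : ∀ {n r m} → Inward n r m →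
                   (∃[ m′ ] m ≡ suc m′ × Inward (suc n) r m′) ⊎ Leaves (suc n) r m
    after-inward (p , q , _) with step-from q
    ... | inj₁ (_ , q′ , _) = ⊥-elim (no-backtrack p q′)
    ... | inj₂ next         = next

    -- On the other ray the arc before the crossing has orientation `not d` and the arc after it
    -- `d`. Walking inward reverses the former, so either exit continues the orientation `d` of the
    -- run of `r` that ends there.
    leaving-orientation : ∀ {n r m} → Leaves n r m → ∃[ c ] ∃[ d ] Side r m c d × o n ≡ d
    leaving-orientation (outward (c , d , side , side′) (_ , _ , on)) =
      c , d , side , trans on (trans (Side-after side′) (not-involutive d))
    leaving-orientation (inward (c , d , side , side′) (_ , _ , on)) =
      c , d , side , trans on (trans (cong not (Side-before side′)) (not-involutive d))

    record Settled : Set where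
      constructor settled
      field
        time     : ℕ
        ray      : Ray
        position : ℕ
        follows  : ∀ i → map f (i + time) ≡ vertex ray (i + position)

    module _ {n r m c d} (T≤n : T ≤ n) (side : Side r m c d) (start : Outward n r m) where

      -- By `Side-gap` the run ending at the exit starts no earlier than `m`, so the copy has
      -- traversed all of it; the exit arc would prolong it, which `bounded` forbids beyond `T`.
      stays : ∀ k → (∀ {i} → i < suc k → Outward (i + n) r (i + m)) → ¬ Leaves (suc k + n) r (suc k + m)
      stays k track leaves with leaving-orientation leaves
      ... | c′ , d′ , side′@(_ , (_ , run) , _) , oe =
        bounded d′ (suc (suc k + n)) (s≤s bound) (Run-extend o run′ oe)
        where
        L≤k : L d′ ≤ suc k
        L≤k = Side-gap k side side′
        bound : T + L d′ ≤ suc k + n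
        bound = ≤-trans (+-mono-≤ T≤n L≤k) (≤-reflexive (+-comm n (suc k)))
        run′ : Run o d′ (L d′) (suc k + n)
        run′ {i} i<L = trans (cong o (+-∸-comm n i<k))
          (trans (proj₂ (proj₂ (track (s≤s (m∸n≤m k i)))))
          (trans (cong o (sym (+-∸-comm m i<k))) (run i<L)))
          where
          i<k : suc i ≤ suc k
          i<k = ≤-trans i<L L≤k

      continues : ∀ k → (∀ {i} → i < suc k → Outward (i + n) r (i + m)) → Outward (suc k + n) r (suc k + m)
      continues k track with after-outward (track (n<1+n k))
      ... | inj₁ out    = out
      ... | inj₂ leaves = ⊥-elim (stays k track leaves)

      outward-forever : ∀ k {i} → i < k → Outward (i + n) r (i + m)
      outward-forever (suc zero)    = <-snoc {λ i → Outward (i + n) r (i + m)} (λ ()) start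
      outward-forever (suc (suc k)) = <-snoc (outward-forever (suc k)) (continues k (outward-forever (suc k)))

      crossing⇒settled : Settled
      crossing⇒settled = settled n r m λ i → proj₁ (outward-forever (suc i) {i} (n<1+n i))

    mutual
      -- Lexicographic induction: `K` bounds the rank and drops whenever the copy changes rays and
      -- still moves inward; between changes the position `m` drops.
      inward⇒settled : ∀ K {n r m} → T ≤ n → rank r (state m) < K → Inward n r m → Settled
      inward⇒settled (suc K) {m = m} T≤n rank<K inw = inward⇒settled′ K m T≤n rank<K inw

      inward⇒settled′ : ∀ K {n r} m → T ≤ n → rank r (state m) < suc K → Inward n r m → Settled
      inward⇒settled′ K m T≤n rank<K inw with after-inward inw
      inward⇒settled′ K (suc m) T≤n rank<K inw | inj₁ (.m , refl , inw′) =
        inward⇒settled′ K m (m≤n⇒m≤1+n T≤n) (≤-<-trans (rank-step _ m) rank<K) inw′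
      ... | inj₂ leaves = leaves⇒settled K (m≤n⇒m≤1+n T≤n) rank<K leaves

      leaves⇒settled : ∀ K {n r m} → T ≤ n → rank r (state m) < suc K → Leaves n r m → Settled
      leaves⇒settled K T≤n _ (outward (_ , _ , _ , side′) out) = crossing⇒settled T≤n side′ out
      leaves⇒settled K T≤n (s≤s rank≤K) (inward (_ , _ , side , side′) inw) =
        inward⇒settled K T≤n
          (<-≤-trans (rank-before-crossing side′) (subst (_≤ K) (rank-at-crossing side) rank≤K)) inw

    -- The walk begins at arc `T`, where `bounded` starts to apply. If it goes outward, it may have
    -- entered midway through a run, so one exit remains possible; whether it occurs is not decided,
    -- hence `¬ ¬`.
    eventually-settled : ¬ ¬ Settled
    eventually-settled ¬settled with step T
    ... | inj₂ (r , m , inw) = ¬settled (inward⇒settled _ ≤-refl (n<1+n _) inw)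
    ... | inj₁ (r , m , out) = ¬settled (settled T r m λ i → proj₁ (track i))
      where
      track : ∀ i → Outward (i + T) r (i + m)
      track zero = out
      track (suc i) with after-outward (track i)
      ... | inj₁ out′   = out′
      ... | inj₂ leaves = ⊥-elim (¬settled (leaves⇒settled _ (m≤n+m T (suc i)) (n<1+n _) leaves))

-- Finite families of rays and disjoint copies

Ray : Set
Ray = ℕ × ℕ

_≟ʳ_ : DecidableEquality Ray
_≟ʳ_ = ≡-dec _≟_ _≟_

-- Family `n` has exactly `n` members; a ray `(n , i)` with `n ≤ i` lies in no family and clashes
-- with every other ray.
SameFamily : Ray → Ray → Set
SameFamily (n , i) (n′ , i′) = n ≡ n′ × i < n × i′ < n

Clash : Ray → Ray → Set
Clash r r′ = r ≢ r′ × ¬ SameFamily r r′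

module Families
  (ends : ℕ → Bool → Ray) (ends-clash : ∀ c → Clash (ends c true) (ends c false))
  (ends-recur : ∀ {r r′} M → Clash r r′ → ∃[ c ] M ≤ c × ends c true ≡ r × ends c false ≡ r′)
  (o : ℕ → Bool) (T : ℕ) (L : Bool → ℕ)
  (L≥1 : ∀ d → 1 ≤ L d) (bounded : ∀ d → RunsBounded o d T (L d))
  (recur : ∀ d → RunsRecur o d (L d))
  where

  open Crossing o T L L≥1 bounded _≟ʳ_ ends (λ c → proj₁ (ends-clash c))
  open Recurrent recur
  open Tail using (Settled; settled; eventually-settled)
  open Tail.Settled using (ray; position)

  -- The rays of family `k` do not clash, so no crossing joins two of them.
  many-copies : ∀ k → HasDisjointCopies (OrientedRay o) G k
  many-copies k = (λ i → ray-copy (k , toℕ i)) , disjoint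
    where
    disjoint : Disjoint (λ (i : Fin k) → ray-copy (k , toℕ i))
    disjoint i j x y eq with vertex-meet {k , toℕ i} {x} {k , toℕ j} {y} eq
    ... | inj₁ (r≡r′ , _) = toℕ-injective (cong proj₂ r≡r′)
    ... | inj₂ (c , true , side , side′) =
      ⊥-elim (proj₂ (subst₂ Clash (Side-ray {m = x} side) (Side-ray {m = y} side′) (ends-clash c))
                    (refl , toℕ<n i , toℕ<n j))
    ... | inj₂ (c , false , side , side′) =
      ⊥-elim (proj₂ (subst₂ Clash (Side-ray {m = y} side′) (Side-ray {m = x} side) (ends-clash c))
                    (refl , toℕ<n j , toℕ<n i))

  settled-at : ∀ {f} (σ : Settled f) {e} → position σ ≤ e → ∃[ x ] map f x ≡ vertex (ray σ) e
  settled-at (settled n r m track) {e} m≤e =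
    e ∸ m + n , trans (track (e ∸ m)) (cong (vertex r) (m∸n+n≡m m≤e))

  same-ray⇒meet : ∀ {f g} (σ : Settled f) (τ : Settled g) → ray σ ≡ ray τ →
                  ∃[ x ] ∃[ y ] map f x ≡ map g y
  same-ray⇒meet σ@(settled _ _ m _) τ@(settled _ _ m′ _) refl
    with settled-at σ (m≤m⊔n m m′) | settled-at τ (m≤n⊔m m m′)
  ... | x , p | y , q = x , y , trans p (sym q)

  clash⇒meet : ∀ {f g} (σ : Settled f) (τ : Settled g) → Clash (ray σ) (ray τ) →
               ¬ ¬ (∃[ x ] ∃[ y ] map f x ≡ map g y)
  clash⇒meet σ@(settled _ r m _) τ@(settled _ r′ m′ _) cl k with ends-recur {r} {r′} (m ⊔ m′) cl
  ... | c , le , refl , refl =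
    crossing-reached c true λ (e , c≤e , v) →
    crossing-reached c false λ (e′ , c≤e′ , v′) →
    let x , p = settled-at σ (≤-trans (m⊔n≤o⇒m≤o m m′ le) c≤e)
        y , q = settled-at τ (≤-trans (m⊔n≤o⇒n≤o m m′ le) c≤e′)
    in k (x , y , trans p (trans v (sym (trans q v′))))

  -- Copies on equal or clashing rays meet, which leaves only a common family; since `SameFamily` is
  -- decidable, the double negation disappears.
  same-family : ∀ {f g} (σ : Settled f) (τ : Settled g) →
                ¬ (∃[ x ] ∃[ y ] map f x ≡ map g y) → SameFamily (ray σ) (ray τ)
  same-family σ τ apart = decidable-stable
    ((proj₁ (ray σ) ≟ proj₁ (ray τ)) ×-dec
     (proj₂ (ray σ) <? proj₁ (ray σ)) ×-dec (proj₂ (ray τ) <? proj₁ (ray σ)))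
    λ ¬fam → clash⇒meet σ τ (apart ∘ same-ray⇒meet σ τ , ¬fam) apart

  no-infinite-copies : ¬ HasInfDisjointCopies (OrientedRay o) G
  no-infinite-copies (f , disjoint) = eventually-settled (f 0) λ σ₀ →
    let n = proj₁ (ray σ₀) in
    -- Being disjoint from copy 0 puts all further copies on the `n` rays of family `n`, so `suc n`
    -- of them force two onto one ray.
    ¬¬-∀Fin (suc n) (λ i → eventually-settled (f (suc (toℕ i)))) λ σ →
    let apart : ∀ {i j} → i ≢ j → ¬ (∃[ x ] ∃[ y ] map (f i) x ≡ map (f j) y)
        apart i≢j (x , y , eq) = i≢j (disjoint _ _ x y eq)
        family : ∀ i → SameFamily (ray σ₀) (ray (σ i))
        family i = same-family σ₀ (σ i) (apart (λ ()))
        index<n : ∀ i → proj₂ (ray (σ i)) < n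
        index<n i = proj₂ (proj₂ (family i))
        i , j , i<j , eq = pigeonhole (n<1+n n) (λ i → fromℕ< (index<n i))
        same-ray : ray (σ i) ≡ ray (σ j)
        same-ray = cong₂ _,_
          (trans (sym (proj₁ (family i))) (proj₁ (family j)))
          (trans (sym (toℕ-fromℕ< (index<n i))) (trans (cong toℕ eq) (toℕ-fromℕ< (index<n j))))
    in apart (<⇒≢ i<j ∘ suc-injective) (same-ray⇒meet (σ i) (σ j) same-ray)

-- Enumerating the crossings

-- Cantor's enumeration along the antidiagonals.
unpair : ℕ → ℕ × ℕ
unpair zero = 0 , 0
unpair (suc n) with unpair n
... | x , zero  = 0 , suc x
... | x , suc y = suc x , y

unpair-surjective : ∀ s x y → x + y ≡ s → ∃[ n ] unpair n ≡ (x , y)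
unpair-surjective s zero zero _ = 0 , refl
unpair-surjective (suc s) zero (suc y) eq
  with unpair-surjective s y 0 (trans (+-identityʳ y) (suc-injective eq))
... | n , un = suc n , lemma
  where
  lemma : unpair (suc n) ≡ (0 , suc y)
  lemma rewrite un = refl
unpair-surjective s (suc x) y eq with unpair-surjective s x (suc y) (trans (+-suc x y) eq)
... | n , un = suc n , lemma
  where
  lemma : unpair (suc n) ≡ (suc x , y)
  lemma rewrite un = refl

unpair-≤ : ∀ n → proj₁ (unpair n) + proj₂ (unpair n) ≤ n
unpair-≤ zero = z≤n
unpair-≤ (suc n) with unpair n | unpair-≤ n
... | x , zero  | le = s≤s (≤-trans (m≤m+n x 0) le)
... | x , suc y | le = m≤n⇒m≤1+n (≤-trans (≤-reflexive (sym (+-suc x y))) le)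

pair : ∀ x y → ∃[ n ] unpair n ≡ (x , y)
pair x y = unpair-surjective (x + y) x y refl

clash? : ∀ r r′ → Dec (Clash r r′)
clash? r@(n , i) r′@(n′ , i′) =
  ¬? (r ≟ʳ r′) ×-dec ¬? ((n ≟ n′) ×-dec (i <? n) ×-dec (i′ <? n))

ClashingPair : Set
ClashingPair = ∃[ r ] ∃[ r′ ] Clash r r′

clashing : ∀ r r′ → Dec (Clash r r′) → ClashingPair
clashing r r′ (yes cl) = r , r′ , cl
-- The default pair clashes because family 0 is empty.
clashing r r′ (no _)   = (0 , 0) , (0 , 1) , (λ ()) , λ ()

-- The first component of `unpair c` codes the pair of rays; varying the second makes each clashing
-- pair recur at arbitrarily large `c`.
stage : ℕ → ClashingPair
stage c = clashing r r′ (clash? r r′)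
  where
  p = unpair (proj₁ (unpair c))
  r = unpair (proj₁ p)
  r′ = unpair (proj₂ p)

ends : ℕ → Bool → Ray
ends c true  = proj₁ (stage c)
ends c false = proj₁ (proj₂ (stage c))

ends-clash : ∀ c → Clash (ends c true) (ends c false)
ends-clash c = proj₂ (proj₂ (stage c))

ends-recur : ∀ {r r′} M → Clash r r′ → ∃[ c ] M ≤ c × ends c true ≡ r × ends c false ≡ r′
ends-recur {r} {r′} M cl with pair (proj₁ r) (proj₂ r) | pair (proj₁ r′) (proj₂ r′)
... | a , ua | b , ub with pair a b
...   | p , up with pair p M
...     | c , uc = c , M≤c , cong proj₁ stage≡ , cong proj₂ stage≡
  where
  M≤c : M ≤ c
  M≤c = ≤-trans (m≤n+m M p) (subst (λ x → proj₁ x + proj₂ x ≤ c) uc (unpair-≤ c))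
  stage≡ : (ends c true , ends c false) ≡ (r , r′)
  stage≡ rewrite uc | up | ua | ub with clash? r r′
  ... | yes _  = refl
  ... | no ¬cl = ⊥-elim (¬cl cl)

theorem4p2 : (o : ℕ → Bool) (s : ℕ → ℕ) → IsRepresentingSequence o s → BoundedSeq s → ¬ Ubiquitous (OrientedRay o)
theorem4p2 o s rep (b , s≤b) ubiquitous =
  largest-recurring-run o true b (0 , bd true) λ (ℓᵗ , (Tᵗ , bdᵗ) , recurᵗ) →
  largest-recurring-run o false b (0 , bd false) λ (ℓᶠ , (Tᶠ , bdᶠ) , recurᶠ) →
  -- One threshold beyond which both orientations obey their bounds.
  let T = Tᵗ ⊔ Tᶠ
      L : Bool → ℕ
      L = λ { true → ℓᵗ ; false → ℓᶠ }
      L≥1 : ∀ d → 1 ≤ L d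
      L≥1 = λ { true  → recurring-run-positive o true (bd false) bdᵗ
              ; false → recurring-run-positive o false (bd true) bdᶠ }
      bounded : ∀ d → RunsBounded o d T (L d)
      bounded = λ { true  → RunsBounded-mono o (m≤m⊔n Tᵗ Tᶠ) bdᵗ
                  ; false → RunsBounded-mono o (m≤n⊔m Tᵗ Tᶠ) bdᶠ }
      recur : ∀ d → RunsRecur o d (L d)
      recur = λ { true → recurᵗ ; false → recurᶠ }
      open Families ends ends-clash ends-recur o T L L≥1 bounded recur
  in no-infinite-copies (ubiquitous _ many-copies)
  where
  bd : ∀ d → RunsBounded o d 0 b
  bd = bounded-phases⇒bounded-runs o s rep s≤b
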